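{- Let $\Sigma$ be a finite alphabet. For all $e,f\in\mathcal{T}_{\mathsf{SF}_1}$, we have \[ e\equiv_{\mathsf{SF}_1} f \iff [\![e]\!]_{\mathsf{SF}_1}=[\![f]\!]_{\mathsf{SF}_1}. \]
   Context: Let $\Sigma$ be a finite alphabet and let $\mathcal{P}_n(\Sigma)$ be the set of non-empty subsets of $\Sigma$. Terms. The semilattice terms $\mathcal{T}_{\mathsf{SL}}$ are given by $e,f ::= a\in\Sigma \mid e\times f$. The $\mathsf{SF}_1$-expressions $\mathcal{T}_{\mathsf{SF}_1}$ are given by $e,f ::= 0\mid 1\mid a\in\mathcal{T}_{\mathsf{SL}}\mid e+f\mid e\cdot f\mid e\times f\mid e^*\mid H(e)$ (so $\mathcal{T}_{\mathsf{SL}}\subseteq\mathcal{T}_{\mathsf{SF}_1}$, and the $\times$ of two semilattice terms is the same term whether formed in $\mathcal{T}_{\mathsf{SL}}$ or in $\mathcal{T}_{\mathsf{SF}_1}$). Provable equivalence. $\equiv_{\mathsf{SF}_1}$ is the smallest congruence $\equiv$ on $\mathcal{T}_{\mathsf{SF}_1}$ (with respect to $+,\cdot,\times,{}^*,H$) satisfying the following for all $e,f,g\in\mathcal{T}_{\mathsf{SF}_1}$ and all $\alpha,\beta\in\mathcal{T}_{\mathsf{SL}}$: - $e+(f+g)\equiv(e+f)+g$, $e+f\equiv f+e$, $e+0\equiv e$, $e+e\equiv e$; - $e\cdot 1\equiv e\equiv 1\cdot e$, $e\cdot 0\equiv 0\equiv 0\cdot e$, $e\cdot(f\cdot g)\equiv(e\cdot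 f)\cdot g$, $(e+f)\cdot g\equiv e\cdot g+f\cdot g$, $e\cdot(f+g)\equiv e\cdot f+e\cdot g$; - $e^*\equiv 1+e\cdot e^*\equiv 1+e^*\cdot e$, $(e+1)^*\equiv e^*$; - (unique fixpoint axiom) if $H(f)\equiv 0$ and $e+f\cdot g\equiv g$, then $f^*\cdot e\equiv g$; - $H(0)\equiv 0$, $H(1)\equiv 1$, $H(e+f)\equiv H(e)+H(f)$, $H(e\cdot f)\equiv H(e)\cdot H(f)$, $H(e^*)\equiv (H(e))^*$, $H(e\times f)\equiv H(e)\times H(f)$, $H(\alpha)\equiv 0$; - $e\times(f+g)\equiv e\times f+e\times g$, $e\times(f\times g)\equiv(e\times f)\times g$, $e\times f\equiv f\times e$, $e\times 0\equiv 0$, $e\times 1\equiv e$; - $\alpha\times\alpha\equiv\alpha$, and $(\alpha\cdot e)\times(\beta\cdot f)\equiv(\alpha\times\beta)\cdot(e\times f)$. Semantics. Synchronous strings are words over the alphabet $\mathcal{P}_n(\Sigma)$; synchronous languages are sets of synchronous strings, with the usual union, concatenation and Kleene star. The synchronous product of strings is defined by $u\times\varepsilon=u=\varepsilon\times u$ and $(x u)\times(y v)=(x\cup y)(u\times v)$ for $x,y\in\mathcal{P}_n(\Sigma)$, and of languages by $K\times L=\{u\times v: u\in K,v\in L\}$. Define $[\![-]\!]_{\mathsf{SL}}:\mathcal{T}_{\mathsf{SL}}\to\mathcal{P}_n(\Sigma)$ by $[\![a]\!]_{\mathsf{SL}}=\{a\}$ for $a\in\Sigma$ and $[\![e\times f]\!]_{\mathsf{SL}}=[\![e]\!]_{\mathsf{SL}}\cup[\![f]\!]_{\mathsf{SL}}$.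 The map $[\![-]\!]_{\mathsf{SF}_1}$ from $\mathcal{T}_{\mathsf{SF}_1}$ to synchronous languages is given by $[\![0]\!]=\emptyset$, $[\![1]\!]=\{\varepsilon\}$, $[\![a]\!]=\{[\![a]\!]_{\mathsf{SL}}\}$ (a single one-letter word) for $a\in\mathcal{T}_{\mathsf{SL}}$, $[\![e+f]\!]=[\![e]\!]\cup[\![f]\!]$, $[\![e\cdot f]\!]=[\![e]\!]\cdot[\![f]\!]$, $[\![e\times f]\!]=[\![e]\!]\times[\![f]\!]$, $[\![e^*]\!]=[\![e]\!]^*$, $[\![H(e)]\!]=[\![e]\!]\cap\{\varepsilon\}$. -}

module Defs where

open import Data.Fin.Base using (Fin)
open import Data.Fin.Subset using (Subset; Nonempty; ⁅_⁆) renaming (_∪_ to _∪ˢ_)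
open import Data.Fin.Subset.Properties using (x∈⁅x⁆; p⊆p∪q)
open import Data.Irrelevant using (Irrelevant; [_]; map)
open import Data.List.Base using (List; []; _∷_; _++_; concat)
open import Data.List.Relation.Unary.All using (All)
open import Data.Nat.Base using (ℕ)
open import Data.Product.Base using (∃; ∃₂; _×_; _,_)
open import Data.Refinement.Base using (Refinement-syntax; _,_; value; proof)
open import Level using (0ℓ)
open import Relation.Binary.PropositionalEquality using (_≡_; refl)
open import Relation.Unary using (Pred; _∈_; _∪_; _∩_; ∅; ｛_｝; _≐_)

-- The finite alphabet is Fin n, where n = 0 is allowed.
private
  variable
    n : ℕ

infixl 6 _⊕_ _+_
infixl 7 _·_ _·ᴸ_
infixl 8 _⊗_ _⊗ʷ_ _⊗ᴸ_
infix  9 _* _⋆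
infix  4 _≡SF₁_

data SL (n : ℕ) : Set where
  letter : Fin n → SL n
  _⊗_    : SL n → SL n → SL n

-- A product of semilattice terms is the same SF₁-term whether it is formed in
-- SL or in SF₁.  So only the letters are leaves here, and the inclusion of SL
-- into SF₁ is the map ⌜_⌝, which is injective and preserves _⊗_.
data SF₁ (n : ℕ) : Set where
  𝟘 𝟙    : SF₁ n
  letter : Fin n → SF₁ n
  _+_    : SF₁ n → SF₁ n → SF₁ n
  _·_    : SF₁ n → SF₁ n → SF₁ n
  _⊗_    : SF₁ n → SF₁ n → SF₁ n
  _*     : SF₁ n → SF₁ n
  H      : SF₁ n → SF₁ n

⌜_⌝ : SL n → SF₁ n
⌜ letter a ⌝ = letter a
⌜ α ⊗ β ⌝    = ⌜ α ⌝ ⊗ ⌜ β ⌝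

data _≡SF₁_ {n : ℕ} : SF₁ n → SF₁ n → Set where
  ≡-refl  : ∀ {e} → e ≡SF₁ e
  ≡-sym   : ∀ {e f} → e ≡SF₁ f → f ≡SF₁ e
  ≡-trans : ∀ {e f g} → e ≡SF₁ f → f ≡SF₁ g → e ≡SF₁ g

  +-cong : ∀ {e e′ f f′} → e ≡SF₁ e′ → f ≡SF₁ f′ → e + f ≡SF₁ e′ + f′
  ·-cong : ∀ {e e′ f f′} → e ≡SF₁ e′ → f ≡SF₁ f′ → e · f ≡SF₁ e′ · f′
  ⊗-cong : ∀ {e e′ f f′} → e ≡SF₁ e′ → f ≡SF₁ f′ → e ⊗ f ≡SF₁ e′ ⊗ f′
  *-cong : ∀ {e e′} → e ≡SF₁ e′ → e * ≡SF₁ e′ *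
  H-cong : ∀ {e e′} → e ≡SF₁ e′ → H e ≡SF₁ H e′

  +-assoc     : ∀ e f g → e + (f + g) ≡SF₁ (e + f) + g
  +-comm      : ∀ e f → e + f ≡SF₁ f + e
  +-identityʳ : ∀ e → e + 𝟘 ≡SF₁ e
  +-idem      : ∀ e → e + e ≡SF₁ e

  ·-identityʳ : ∀ e → e · 𝟙 ≡SF₁ e
  ·-identityˡ : ∀ e → 𝟙 · e ≡SF₁ e
  ·-zeroʳ     : ∀ e → e · 𝟘 ≡SF₁ 𝟘
  ·-zeroˡ     : ∀ e → 𝟘 · e ≡SF₁ 𝟘
  ·-assoc     : ∀ e f g → e · (f · g) ≡SF₁ (e · f) · g
  ·-distribʳ  : ∀ e f g → (e + f) · g ≡SF₁ e · g + f · g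
  ·-distribˡ  : ∀ e f g → e · (f + g) ≡SF₁ e · f + e · g

  *-unfoldˡ : ∀ e → e * ≡SF₁ 𝟙 + e · e *
  *-unfoldʳ : ∀ e → e * ≡SF₁ 𝟙 + e * · e
  *-loop    : ∀ e → (e + 𝟙) * ≡SF₁ e *

  unique-fixpoint : ∀ {e f g} → H f ≡SF₁ 𝟘 → e + f · g ≡SF₁ g → f * · e ≡SF₁ g

  H-𝟘  : H 𝟘 ≡SF₁ 𝟘
  H-𝟙  : H 𝟙 ≡SF₁ 𝟙
  H-+  : ∀ e f → H (e + f) ≡SF₁ H e + H f
  H-·  : ∀ e f → H (e · f) ≡SF₁ H e · H f
  H-*  : ∀ e → H (e *) ≡SF₁ (H e) *
  H-⊗  : ∀ e f → H (e ⊗ f) ≡SF₁ H e ⊗ H f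
  H-SL : ∀ (α : SL n) → H ⌜ α ⌝ ≡SF₁ 𝟘

  ⊗-distribˡ  : ∀ e f g → e ⊗ (f + g) ≡SF₁ e ⊗ f + e ⊗ g
  ⊗-assoc     : ∀ e f g → e ⊗ (f ⊗ g) ≡SF₁ (e ⊗ f) ⊗ g
  ⊗-comm      : ∀ e f → e ⊗ f ≡SF₁ f ⊗ e
  ⊗-zeroʳ     : ∀ e → e ⊗ 𝟘 ≡SF₁ 𝟘
  ⊗-identityʳ : ∀ e → e ⊗ 𝟙 ≡SF₁ e

  ⊗-idem-SL : ∀ (α : SL n) → ⌜ α ⌝ ⊗ ⌜ α ⌝ ≡SF₁ ⌜ α ⌝
  ⊗-sync    : ∀ (α β : SL n) e f →
              (⌜ α ⌝ · e) ⊗ (⌜ β ⌝ · f) ≡SF₁ (⌜ α ⌝ ⊗ ⌜ β ⌝) · (e ⊗ f)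

-- The non-emptiness proof is irrelevant, so elements of 𝒫ₙ with equal
-- underlying subsets are propositionally equal.
𝒫ₙ : ℕ → Set
𝒫ₙ n = [ p ∈ Subset n ∣ Nonempty p ]

singleton : Fin n → 𝒫ₙ n
singleton a = ⁅ a ⁆ , [ (a , x∈⁅x⁆ a) ]

_⊕_ : 𝒫ₙ n → 𝒫ₙ n → 𝒫ₙ n
x ⊕ y = (value x ∪ˢ value y) ,
        map (λ (a , a∈x) → a , p⊆p∪q (value y) a∈x) (proof x)

SyncString : ℕ → Set
SyncString n = List (𝒫ₙ n)

SyncLanguage : ℕ → Set₁
SyncLanguage n = Pred (SyncString n) 0ℓ

_⊗ʷ_ : SyncString n → SyncString n → SyncString n
[]      ⊗ʷ v       = v
(x ∷ u) ⊗ʷ []      = x ∷ u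
(x ∷ u) ⊗ʷ (y ∷ v) = (x ⊕ y) ∷ (u ⊗ʷ v)

_·ᴸ_ : SyncLanguage n → SyncLanguage n → SyncLanguage n
(K ·ᴸ L) w = ∃₂ λ u v → u ∈ K × v ∈ L × u ++ v ≡ w

_⊗ᴸ_ : SyncLanguage n → SyncLanguage n → SyncLanguage n
(K ⊗ᴸ L) w = ∃₂ λ u v → u ∈ K × v ∈ L × u ⊗ʷ v ≡ w

_⋆ : SyncLanguage n → SyncLanguage n
(L ⋆) w = ∃ λ us → All L us × concat us ≡ w

⟦_⟧SL : SL n → 𝒫ₙ n
⟦ letter a ⟧SL = singleton a
⟦ α ⊗ β ⟧SL    = ⟦ α ⟧SL ⊕ ⟦ β ⟧SL

⟦_⟧ : SF₁ n → SyncLanguage n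
⟦ 𝟘 ⟧        = ∅
⟦ 𝟙 ⟧        = ｛ [] ｝
⟦ letter a ⟧ = ｛ ⟦ letter a ⟧SL ∷ [] ｝
⟦ e + f ⟧    = ⟦ e ⟧ ∪ ⟦ f ⟧
⟦ e · f ⟧    = ⟦ e ⟧ ·ᴸ ⟦ f ⟧
⟦ e ⊗ f ⟧    = ⟦ e ⟧ ⊗ᴸ ⟦ f ⟧
⟦ e * ⟧      = ⟦ e ⟧ ⋆
⟦ H e ⟧      = ⟦ e ⟧ ∩ ｛ [] ｝

-- The semantic clause for an arbitrary semilattice term, which ⟦_⟧ imposes
-- only at letters.
⟦⌜_⌝⟧ : (α : SL n) → ⟦ ⌜ α ⌝ ⟧ ≐ ｛ ⟦ α ⟧SL ∷ [] ｝
⟦⌜ α ⌝⟧ = to α , from α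
  where
  to : (α : SL n) → ∀ {w} → w ∈ ⟦ ⌜ α ⌝ ⟧ → ⟦ α ⟧SL ∷ [] ≡ w
  to (letter a) eq = eq
  to (α ⊗ β) (u , v , u∈α , v∈β , refl) with to α u∈α | to β v∈β
  ... | refl | refl = refl

  from : (α : SL n) → ∀ {w} → ⟦ α ⟧SL ∷ [] ≡ w → w ∈ ⟦ ⌜ α ⌝ ⟧
  from (letter a) eq   = eq
  from (α ⊗ β)    refl = _ , _ , from α refl , from β refl , refl

{-# OPTIONS --safe #-}

-- Completeness follows Salomaa.  Every expression is a component of a solution of a finite
-- linear system x = o(x) + Σ α · x′ whose coefficients α are semilattice terms, that is, a
-- state of a nondeterministic automaton.  The subset construction makes the system
-- deterministic.  For two expressions e and f, the pairs (S , T) of sets of states with equal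
-- languages form a deterministic system that is solved both by the sums over S and by the
-- sums over T.  Its coefficients are guarded, so by the unique fixpoint axiom and Gaussian
-- elimination the two solutions agree, in particular at the pair that represents (e , f).
module Submission where

open import Defs
open import Algebra.Bundles using (CommutativeSemigroup)
import Algebra.Properties.CommutativeSemigroup as CommutativeSemigroupProperties
open import Data.Bool.Base using (Bool; true; false; _∧_; _∨_; if_then_else_)
open import Data.Bool.ListAction using (any)
import Data.Bool.Properties as Bool
open import Data.Fin.Base using (Fin)
open import Data.Fin.Subset using (Subset) renaming (_∈_ to _∈ˢ_; _⊆_ to _⊆ˢ_)
open import Data.Fin.Subset.Properties
  using (∪-assoc; ∪-comm; ∪-idem; x∈⁅x⁆; x∈⁅y⁆⇒x≡y; x∈p∪q⁻; x∈p∪q⁺; ⊆-reflexive)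
open import Data.List.Base
  using (List; []; _∷_; _++_; map; concat; concatMap; filter; length; cartesianProduct; cartesianProductWith)
import Data.List.Membership.DecPropositional as DecMembership
open import Data.List.Membership.Propositional using (lose) renaming (_∈_ to _∈ˡ_)
open import Data.List.Membership.Propositional.Properties
  using ( ∈-map⁺; ∈-map⁻; ∈-++⁺ˡ; ∈-++⁺ʳ; ∈-filter⁺; ∈-filter⁻
        ; ∈-concatMap⁺; ∈-concatMap⁻; ∈-cartesianProduct⁺)
import Data.List.Properties as List
open import Data.List.Properties using (++-assoc; ++-identityʳ; concat-++; length-++)
open import Data.List.Relation.Unary.All as All using (All; []; _∷_)
open import Data.List.Relation.Unary.All.Properties using (++⁺)
open import Data.List.Relation.Unary.Any as Any using (here; there)
open import Data.Nat.Base using (ℕ; suc; _≤_; s≤s)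
open import Data.Nat.Properties using (≤-trans; ≤-refl; ≤-reflexive; m≤n+m)
open import Data.Product.Base using (Σ-syntax; ∃; _×_; _,_; proj₁; proj₂; map₂; swap)
import Data.Product.Properties as Product
open import Data.Refinement.Base using (value)
open import Data.Sum.Base as Sum using (_⊎_; inj₁; inj₂; [_,_])
import Data.Sum.Properties as Sum
open import Data.Unit.Base using (⊤; tt)
import Data.Unit.Properties as Unit
import Data.Vec.Properties as Vec
open import Function.Base using (id; _∘_)
open import Function.Bundles using (_⇔_; mk⇔)
open import Level using (0ℓ)
open import Relation.Binary.Bundles using (Setoid)
open import Relation.Binary.Definitions using (DecidableEquality)
open import Relation.Binary.PropositionalEquality
  using (_≡_; refl; sym; trans; cong; cong₂; subst)
import Relation.Binary.Reasoning.Setoid as SetoidReasoning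
open import Relation.Nullary.Decidable using (yes; no)
open import Relation.Nullary.Negation using (¬_; contradiction)
open import Relation.Unary using (_∈_; _⊆_; _≐_; _∪_; ∅; Decidable)

private
  variable
    n : ℕ
    A B C X Y : Set
    e f g : SF₁ n

-- Soundness

𝒫ₙ-≡ : {x y : 𝒫ₙ n} → value x ≡ value y → x ≡ y
𝒫ₙ-≡ refl = refl

⊕-assoc : (x y z : 𝒫ₙ n) → (x ⊕ y) ⊕ z ≡ x ⊕ (y ⊕ z)
⊕-assoc x y z = 𝒫ₙ-≡ (∪-assoc (value x) (value y) (value z))

⊕-comm : (x y : 𝒫ₙ n) → x ⊕ y ≡ y ⊕ x
⊕-comm x y = 𝒫ₙ-≡ (∪-comm (value x) (value y))

⊕-idem : (x : 𝒫ₙ n) → x ⊕ x ≡ x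
⊕-idem x = 𝒫ₙ-≡ (∪-idem (value x))

⊗ʷ-identityʳ : (u : SyncString n) → u ⊗ʷ [] ≡ u
⊗ʷ-identityʳ []      = refl
⊗ʷ-identityʳ (x ∷ u) = refl

⊗ʷ-comm : (u v : SyncString n) → u ⊗ʷ v ≡ v ⊗ʷ u
⊗ʷ-comm []      v       = sym (⊗ʷ-identityʳ v)
⊗ʷ-comm (x ∷ u) []      = refl
⊗ʷ-comm (x ∷ u) (y ∷ v) = cong₂ _∷_ (⊕-comm x y) (⊗ʷ-comm u v)

⊗ʷ-assoc : (u v w : SyncString n) → (u ⊗ʷ v) ⊗ʷ w ≡ u ⊗ʷ (v ⊗ʷ w)
⊗ʷ-assoc []      v       w       = refl
⊗ʷ-assoc (x ∷ u) []      w       = refl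
⊗ʷ-assoc (x ∷ u) (y ∷ v) []      = refl
⊗ʷ-assoc (x ∷ u) (y ∷ v) (z ∷ w) = cong₂ _∷_ (⊕-assoc x y z) (⊗ʷ-assoc u v w)

⊗ᴸ-comm : (K L : SyncLanguage n) → K ⊗ᴸ L ⊆ L ⊗ᴸ K
⊗ᴸ-comm K L (u , v , u∈K , v∈L , refl) = v , u , v∈L , u∈K , ⊗ʷ-comm v u

-- The list of factors is given by its head and tail because it must be nonempty: the recursion
-- walks along it and splits off the last word.
⋆-unfoldʳ : (L : SyncLanguage n) (u : SyncString n) (us : List (SyncString n)) →
            u ∈ L → All L us → (L ⋆ ·ᴸ L) (u ++ concat us)
⋆-unfoldʳ L u []       p []       = [] , u , ([] , [] , refl) , p , sym (++-identityʳ u)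
⋆-unfoldʳ L u (v ∷ us) p (q ∷ qs) with ⋆-unfoldʳ L v us q qs
... | _ , z , (ws , rs , refl) , z∈L , eq =
  _ , z , (u ∷ ws , p ∷ rs , refl) , z∈L ,
  trans (++-assoc u (concat ws) z) (cong (u ++_) eq)

-- Serves the axiom `*-loop`: the factors contributed by `𝟙` are empty words, so deleting them
-- leaves the concatenation unchanged.
⋆-drop-ε : (L : SyncLanguage n) (us : List (SyncString n)) →
           All (λ u → u ∈ L ⊎ [] ≡ u) us → (L ⋆) (concat us)
⋆-drop-ε L []       []              = [] , [] , refl
⋆-drop-ε L (u ∷ us) (inj₁ p ∷ qs) with ⋆-drop-ε L us qs
... | vs , rs , eq = u ∷ vs , p ∷ rs , cong (u ++_) eq
⋆-drop-ε L (_ ∷ us) (inj₂ refl ∷ qs) = ⋆-drop-ε L us qs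

All-ε-concat : {us : List (SyncString n)} → All ([] ≡_) us → [] ≡ concat us
All-ε-concat []          = refl
All-ε-concat (refl ∷ ps) = All-ε-concat ps

-- The half of Arden's lemma that holds for every `L`: starting from a word of `K`, `fold` puts the
-- factors in front one at a time.
⋆-least : (K L M : SyncLanguage n) → K ∪ (L ·ᴸ M) ⊆ M → (L ⋆) ·ᴸ K ⊆ M
⋆-least K L M fold (_ , v , (us , ps , refl) , v∈K , refl) = go us ps
  where
  go : ∀ us → All L us → (concat us ++ v) ∈ M
  go []       []       = fold (inj₁ v∈K)
  go (u ∷ us) (p ∷ ps) =
    fold (inj₂ (u , concat us ++ v , p , go us ps , sym (++-assoc u (concat us) v)))

-- The other half of Arden's lemma. Since `L` omits the empty word, each unfolding removes a
-- nonempty prefix, so the process ends in `K` after finitely many rounds.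
⋆-greatest : (K L M : SyncLanguage n) → ¬ [] ∈ L → M ⊆ K ∪ (L ·ᴸ M) → M ⊆ (L ⋆) ·ᴸ K
⋆-greatest K L M ε∉L unfold {w} = go (length w) w ≤-refl
  where
  suffix-≤ : ∀ u v → length v ≤ length (u ++ v)
  suffix-≤ u v = ≤-trans (m≤n+m _ _) (≤-reflexive (sym (length-++ u)))

  go : ∀ k w → length w ≤ k → w ∈ M → w ∈ (L ⋆) ·ᴸ K
  go k w w≤k w∈M with unfold w∈M
  ... | inj₁ w∈K = [] , w , ([] , [] , refl) , w∈K , refl
  ... | inj₂ ([] , v , ε∈L , v∈M , eq) = contradiction ε∈L ε∉L
  -- `k` bounds the length of the word. The letter `x` is consumed here, so `v`, being a suffix of
  -- `u ++ v`, satisfies the smaller bound.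
  go (suc k) _ (s≤s w≤k) w∈M | inj₂ (x ∷ u , v , p , v∈M , refl)
    with go k v (≤-trans (suffix-≤ u v) w≤k) v∈M
  ... | _ , z , (us , ps , refl) , z∈K , refl =
    _ , z , ((x ∷ u) ∷ us , p ∷ ps , refl) , z∈K , ++-assoc (x ∷ u) (concat us) z

sound : {e f : SF₁ n} → e ≡SF₁ f → ⟦ e ⟧ ≐ ⟦ f ⟧
sound ≡-refl        = id , id
sound (≡-sym p)     = swap (sound p)
sound (≡-trans p q) =
  (λ x → proj₁ (sound q) (proj₁ (sound p) x)) , (λ x → proj₂ (sound p) (proj₂ (sound q) x))
sound (+-cong p q) =
  Sum.map (proj₁ (sound p)) (proj₁ (sound q)) , Sum.map (proj₂ (sound p)) (proj₂ (sound q))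
sound (·-cong p q) =
  (λ (u , v , a , b , eq) → u , v , proj₁ (sound p) a , proj₁ (sound q) b , eq) ,
  (λ (u , v , a , b , eq) → u , v , proj₂ (sound p) a , proj₂ (sound q) b , eq)
sound (⊗-cong p q) =
  (λ (u , v , a , b , eq) → u , v , proj₁ (sound p) a , proj₁ (sound q) b , eq) ,
  (λ (u , v , a , b , eq) → u , v , proj₂ (sound p) a , proj₂ (sound q) b , eq)
sound (*-cong p) =
  (λ (us , as , eq) → us , All.map (proj₁ (sound p)) as , eq) ,
  (λ (us , as , eq) → us , All.map (proj₂ (sound p)) as , eq)
sound (H-cong p) =
  (λ (a , eq) → proj₁ (sound p) a , eq) , (λ (a , eq) → proj₂ (sound p) a , eq)
sound (+-assoc e f g) = Sum.assocˡ , Sum.assocʳ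
sound (+-comm e f) = Sum.swap , Sum.swap
sound (+-identityʳ e) = (λ { (inj₁ p) → p }) , inj₁
sound (+-idem e) = Sum.[ id , id ] , inj₁
sound (·-identityʳ e) =
  (λ { (u , _ , p , refl , refl) → subst ⟦ e ⟧ (sym (++-identityʳ u)) p }) ,
  (λ {u} p → u , [] , p , refl , ++-identityʳ u)
sound (·-identityˡ e) = (λ { (_ , u , refl , p , refl) → p }) , (λ {u} p → [] , u , refl , p , refl)
sound (·-zeroʳ e) = (λ { (_ , _ , _ , () , _) }) , λ ()
sound (·-zeroˡ e) = (λ { (_ , _ , () , _) }) , λ ()
sound (·-assoc e f g) =
  (λ { (u , _ , p , (v , w , q , r , refl) , refl) →
       u ++ v , w , (u , v , p , q , refl) , r , ++-assoc u v w }) ,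
  (λ { (_ , w , (u , v , p , q , refl) , r , refl) →
       u , v ++ w , p , (v , w , q , r , refl) , sym (++-assoc u v w) })
sound (·-distribʳ e f g) =
  (λ { (u , v , inj₁ p , q , eq) → inj₁ (u , v , p , q , eq)
     ; (u , v , inj₂ p , q , eq) → inj₂ (u , v , p , q , eq) }) ,
  (λ { (inj₁ (u , v , p , q , eq)) → u , v , inj₁ p , q , eq
     ; (inj₂ (u , v , p , q , eq)) → u , v , inj₂ p , q , eq })
sound (·-distribˡ e f g) =
  (λ { (u , v , p , inj₁ q , eq) → inj₁ (u , v , p , q , eq)
     ; (u , v , p , inj₂ q , eq) → inj₂ (u , v , p , q , eq) }) ,
  (λ { (inj₁ (u , v , p , q , eq)) → u , v , p , inj₁ q , eq
     ; (inj₂ (u , v , p , q , eq)) → u , v , p , inj₂ q , eq })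
sound (*-unfoldˡ e) =
  (λ { ([] , [] , eq) → inj₁ eq
     ; (u ∷ us , p ∷ ps , eq) → inj₂ (u , concat us , p , (us , ps , refl) , eq) }) ,
  (λ { (inj₁ eq) → [] , [] , eq
     ; (inj₂ (u , _ , p , (us , ps , refl) , eq)) → u ∷ us , p ∷ ps , eq })
sound (*-unfoldʳ e) =
  (λ { ([] , [] , eq) → inj₁ eq
     ; (u ∷ us , p ∷ ps , refl) → inj₂ (⋆-unfoldʳ ⟦ e ⟧ u us p ps) }) ,
  (λ { (inj₁ eq) → [] , [] , eq
     ; (inj₂ (_ , v , (us , ps , refl) , p , refl)) →
       us ++ (v ∷ []) , ++⁺ ps (p ∷ []) ,
       trans (sym (concat-++ us (v ∷ []))) (cong (concat us ++_) (++-identityʳ v)) })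
sound (*-loop e) =
  (λ { (us , ps , refl) → ⋆-drop-ε ⟦ e ⟧ us ps }) ,
  (λ (us , ps , eq) → us , All.map inj₁ ps , eq)
sound (unique-fixpoint {e} {f} {g} p q) =
  ⋆-least ⟦ e ⟧ ⟦ f ⟧ ⟦ g ⟧ (proj₁ (sound q)) ,
  -- Soundness of `H f ≡SF₁ 𝟘` says exactly that the empty word is not in the language of `f`.
  ⋆-greatest ⟦ e ⟧ ⟦ f ⟧ ⟦ g ⟧ (λ ε∈f → proj₁ (sound p) (ε∈f , refl)) (proj₂ (sound q))
sound H-𝟘 = (λ ()) , λ ()
sound H-𝟙 = proj₁ , λ p → p , p
sound (H-+ e f) =
  (λ { (inj₁ p , eq) → inj₁ (p , eq) ; (inj₂ p , eq) → inj₂ (p , eq) }) ,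
  (λ { (inj₁ (p , eq)) → inj₁ p , eq ; (inj₂ (p , eq)) → inj₂ p , eq })
sound (H-· e f) =
  (λ { (([] , [] , p , q , refl) , refl) → [] , [] , (p , refl) , (q , refl) , refl }) ,
  (λ { (_ , _ , (p , refl) , (q , refl) , refl) → ([] , [] , p , q , refl) , refl })
sound (H-* e) =
  (λ { (_ , eq) → [] , [] , eq }) ,
  (λ { (us , ps , refl) → (us , All.map proj₁ ps , refl) , All-ε-concat (All.map proj₂ ps) })
sound (H-⊗ e f) =
  (λ { (([] , [] , p , q , refl) , refl) → [] , [] , (p , refl) , (q , refl) , refl
     ; ((_ ∷ _ , [] , _ , _ , refl) , ())
     ; ((_ ∷ _ , _ ∷ _ , _ , _ , refl) , ()) }) ,
  (λ { (_ , _ , (p , refl) , (q , refl) , refl) → ([] , [] , p , q , refl) , refl })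
sound (H-SL α) = to , λ ()
  where
  to : ⟦ H ⌜ α ⌝ ⟧ ⊆ ∅
  to (p , refl) with () ← proj₁ ⟦⌜ α ⌝⟧ p
sound (⊗-distribˡ e f g) =
  (λ { (u , v , p , inj₁ q , eq) → inj₁ (u , v , p , q , eq)
     ; (u , v , p , inj₂ q , eq) → inj₂ (u , v , p , q , eq) }) ,
  (λ { (inj₁ (u , v , p , q , eq)) → u , v , p , inj₁ q , eq
     ; (inj₂ (u , v , p , q , eq)) → u , v , p , inj₂ q , eq })
sound (⊗-assoc e f g) =
  (λ { (u , _ , p , (v , w , q , r , refl) , refl) →
       u ⊗ʷ v , w , (u , v , p , q , refl) , r , ⊗ʷ-assoc u v w }) ,
  (λ { (_ , w , (u , v , p , q , refl) , r , refl) →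
       u , v ⊗ʷ w , p , (v , w , q , r , refl) , sym (⊗ʷ-assoc u v w) })
sound (⊗-comm e f) = ⊗ᴸ-comm ⟦ e ⟧ ⟦ f ⟧ , ⊗ᴸ-comm ⟦ f ⟧ ⟦ e ⟧
sound (⊗-zeroʳ e) = (λ { (_ , _ , _ , () , _) }) , λ ()
sound (⊗-identityʳ e) =
  (λ { (u , _ , p , refl , refl) → subst ⟦ e ⟧ (sym (⊗ʷ-identityʳ u)) p }) ,
  (λ {u} p → u , [] , p , refl , ⊗ʷ-identityʳ u)
sound (⊗-idem-SL α) = to , from
  where
  to : ⟦ ⌜ α ⌝ ⊗ ⌜ α ⌝ ⟧ ⊆ ⟦ ⌜ α ⌝ ⟧
  to (_ , _ , p , q , refl) with proj₁ ⟦⌜ α ⌝⟧ p | proj₁ ⟦⌜ α ⌝⟧ q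
  ... | refl | refl = proj₂ ⟦⌜ α ⌝⟧ (cong (_∷ []) (sym (⊕-idem ⟦ α ⟧SL)))
  from : ⟦ ⌜ α ⌝ ⟧ ⊆ ⟦ ⌜ α ⌝ ⊗ ⌜ α ⌝ ⟧
  from p with proj₁ ⟦⌜ α ⌝⟧ p
  ... | refl = _ , _ , p , p , cong (_∷ []) (⊕-idem ⟦ α ⟧SL)
sound (⊗-sync α β e f) = to , from
  where
  to : ⟦ (⌜ α ⌝ · e) ⊗ (⌜ β ⌝ · f) ⟧ ⊆ ⟦ (⌜ α ⌝ ⊗ ⌜ β ⌝) · (e ⊗ f) ⟧
  to (_ , _ , (_ , u , p , u∈e , refl) , (_ , v , q , v∈f , refl) , refl)
    with proj₁ ⟦⌜ α ⌝⟧ p | proj₁ ⟦⌜ β ⌝⟧ q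
  ... | refl | refl = _ , _ , (_ , _ , p , q , refl) , (u , v , u∈e , v∈f , refl) , refl
  from : ⟦ (⌜ α ⌝ ⊗ ⌜ β ⌝) · (e ⊗ f) ⟧ ⊆ ⟦ (⌜ α ⌝ · e) ⊗ (⌜ β ⌝ · f) ⟧
  from (_ , _ , (_ , _ , p , q , refl) , (u , v , u∈e , v∈f , refl) , refl)
    with proj₁ ⟦⌜ α ⌝⟧ p | proj₁ ⟦⌜ β ⌝⟧ q
  ... | refl | refl = _ , _ , (_ , u , p , u∈e , refl) , (_ , v , q , v∈f , refl) , refl

-- Derived laws and finite sums

SF₁-setoid : ℕ → Setoid 0ℓ 0ℓ
SF₁-setoid n = record
  { Carrier       = SF₁ n
  ; _≈_           = _≡SF₁_
  ; isEquivalence = record { refl = ≡-refl ; sym = ≡-sym ; trans = ≡-trans }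
  }

+-commutativeSemigroup : ℕ → CommutativeSemigroup 0ℓ 0ℓ
+-commutativeSemigroup n = record
  { Carrier = SF₁ n
  ; _≈_     = _≡SF₁_
  ; _∙_     = _+_
  ; isCommutativeSemigroup = record
    { isSemigroup = record
      { isMagma = record
        { isEquivalence = Setoid.isEquivalence (SF₁-setoid n)
        ; ∙-cong        = +-cong
        }
      ; assoc = λ e f g → ≡-sym (+-assoc e f g)
      }
    ; comm = +-comm
    }
  }

module ≡SF₁-Reasoning {n : ℕ} = SetoidReasoning (SF₁-setoid n)
open ≡SF₁-Reasoning

+-congˡ : e ≡SF₁ f → g + e ≡SF₁ g + f
+-congˡ = +-cong ≡-refl

+-congʳ : e ≡SF₁ f → e + g ≡SF₁ f + g
+-congʳ p = +-cong p ≡-refl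

·-congˡ : e ≡SF₁ f → g · e ≡SF₁ g · f
·-congˡ = ·-cong ≡-refl

·-congʳ : e ≡SF₁ f → e · g ≡SF₁ f · g
·-congʳ p = ·-cong p ≡-refl

+-identityˡ : (e : SF₁ n) → 𝟘 + e ≡SF₁ e
+-identityˡ e = ≡-trans (+-comm 𝟘 e) (+-identityʳ e)

+-interchange : (a b c d : SF₁ n) → (a + b) + (c + d) ≡SF₁ (a + c) + (b + d)
+-interchange {n} = CommutativeSemigroupProperties.interchange (+-commutativeSemigroup n)

⊗-distribʳ : (e f g : SF₁ n) → (f + g) ⊗ e ≡SF₁ f ⊗ e + g ⊗ e
⊗-distribʳ e f g = begin
  (f + g) ⊗ e   ≈⟨ ⊗-comm _ _ ⟩
  e ⊗ (f + g)   ≈⟨ ⊗-distribˡ e f g ⟩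
  e ⊗ f + e ⊗ g ≈⟨ +-cong (⊗-comm _ _) (⊗-comm _ _) ⟩
  f ⊗ e + g ⊗ e ∎

⊗-zeroˡ : (e : SF₁ n) → 𝟘 ⊗ e ≡SF₁ 𝟘
⊗-zeroˡ e = ≡-trans (⊗-comm 𝟘 e) (⊗-zeroʳ e)

-- The order induced by the idempotent sum

infix 4 _≼_

-- Equations between sums are proved by antisymmetry of this order, which makes repetitions and
-- rearrangements of summands harmless.
_≼_ : SF₁ n → SF₁ n → Set
e ≼ f = e + f ≡SF₁ f

≼-reflexive : e ≡SF₁ f → e ≼ f
≼-reflexive {f = f} p = ≡-trans (+-congʳ p) (+-idem f)

≼-trans : e ≼ f → f ≼ g → e ≼ g
≼-trans {e = e} {f} {g} p q = begin
  e + g       ≈⟨ +-congˡ q ⟨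
  e + (f + g) ≈⟨ +-assoc e f g ⟩
  (e + f) + g ≈⟨ +-congʳ p ⟩
  f + g       ≈⟨ q ⟩
  g           ∎

≼-antisym : e ≼ f → f ≼ e → e ≡SF₁ f
≼-antisym p q = ≡-trans (≡-sym q) (≡-trans (+-comm _ _) p)

𝟘-≼ : (e : SF₁ n) → 𝟘 ≼ e
𝟘-≼ = +-identityˡ

+-≼ : e ≼ g → f ≼ g → e + f ≼ g
+-≼ p q = ≡-trans (≡-sym (+-assoc _ _ _)) (≡-trans (+-congˡ q) p)

≼-+ˡ : (e f : SF₁ n) → e ≼ e + f
≼-+ˡ e f = ≡-trans (+-assoc e e f) (+-congʳ (+-idem e))

≼-+ʳ : (e f : SF₁ n) → f ≼ e + f
≼-+ʳ e f = ≼-trans (≼-+ˡ f e) (≼-reflexive (+-comm f e))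

·-monoʳ-≼ : e ≼ f → g · e ≼ g · f
·-monoʳ-≼ p = ≡-trans (≡-sym (·-distribˡ _ _ _)) (·-congˡ p)

·-monoˡ-≼ : e ≼ f → e · g ≼ f · g
·-monoˡ-≼ p = ≡-trans (≡-sym (·-distribʳ _ _ _)) (·-congʳ p)

-- Finite sums and Boolean constants

∑ : (A → SF₁ n) → List A → SF₁ n
∑ f []       = 𝟘
∑ f (x ∷ xs) = f x + ∑ f xs

∑-cong : {f g : A → SF₁ n} → (∀ x → f x ≡SF₁ g x) → ∀ xs → ∑ f xs ≡SF₁ ∑ g xs
∑-cong p []       = ≡-refl
∑-cong p (x ∷ xs) = +-cong (p x) (∑-cong p xs)

∑-++ : (f : A → SF₁ n) (xs ys : List A) → ∑ f (xs ++ ys) ≡SF₁ ∑ f xs + ∑ f ys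
∑-++ f []       ys = ≡-sym (+-identityˡ _)
∑-++ f (x ∷ xs) ys = ≡-trans (+-congˡ (∑-++ f xs ys)) (+-assoc _ _ _)

∑-map : (f : B → SF₁ n) (h : A → B) (xs : List A) → ∑ f (map h xs) ≡SF₁ ∑ (f ∘ h) xs
∑-map f h []       = ≡-refl
∑-map f h (x ∷ xs) = +-congˡ (∑-map f h xs)

∑-+ : (f g : A → SF₁ n) (xs : List A) → ∑ (λ x → f x + g x) xs ≡SF₁ ∑ f xs + ∑ g xs
∑-+ f g []       = ≡-sym (+-idem 𝟘)
∑-+ f g (x ∷ xs) = ≡-trans (+-congˡ (∑-+ f g xs)) (+-interchange _ _ _ _)

∑-distribʳ : (f : A → SF₁ n) (xs : List A) (g : SF₁ n) → ∑ f xs · g ≡SF₁ ∑ (λ x → f x · g) xs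
∑-distribʳ f []       g = ·-zeroˡ g
∑-distribʳ f (x ∷ xs) g = ≡-trans (·-distribʳ _ _ _) (+-congˡ (∑-distribʳ f xs g))

∑-distribˡ : (f : A → SF₁ n) (xs : List A) (g : SF₁ n) → g · ∑ f xs ≡SF₁ ∑ (λ x → g · f x) xs
∑-distribˡ f []       g = ·-zeroʳ g
∑-distribˡ f (x ∷ xs) g = ≡-trans (·-distribˡ _ _ _) (+-congˡ (∑-distribˡ f xs g))

-- Bilinearity of `⊗`. For sums over transitions the hypothesis on single summands is the axiom
-- `⊗-sync`.
∑-⊗ : (f : A → SF₁ n) (g : B → SF₁ n) (h : C → SF₁ n) (k : A → B → C) →
      (∀ x y → f x ⊗ g y ≡SF₁ h (k x y)) → ∀ xs ys →
      ∑ f xs ⊗ ∑ g ys ≡SF₁ ∑ h (cartesianProductWith k xs ys)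
∑-⊗ f g h k p []       ys = ⊗-zeroˡ _
∑-⊗ f g h k p (x ∷ xs) ys = begin
  (f x + ∑ f xs) ⊗ ∑ g ys
    ≈⟨ ⊗-distribʳ _ _ _ ⟩
  f x ⊗ ∑ g ys + ∑ f xs ⊗ ∑ g ys
    ≈⟨ +-cong (row ys) (∑-⊗ f g h k p xs ys) ⟩
  ∑ h (map (k x) ys) + ∑ h (cartesianProductWith k xs ys)
    ≈⟨ ∑-++ h (map (k x) ys) _ ⟨
  ∑ h (map (k x) ys ++ cartesianProductWith k xs ys) ∎
  where
  row : ∀ ys → f x ⊗ ∑ g ys ≡SF₁ ∑ h (map (k x) ys)
  row []       = ⊗-zeroʳ _
  row (y ∷ ys) = ≡-trans (⊗-distribˡ _ _ _) (+-cong (p x y) (row ys))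

∑-upper : (f : A → SF₁ n) {x : A} {xs : List A} → x ∈ˡ xs → f x ≼ ∑ f xs
∑-upper f (here refl) = ≼-+ˡ _ _
∑-upper f (there x∈)  = ≼-trans (∑-upper f x∈) (≼-+ʳ _ _)

∑-least : {f : A → SF₁ n} {g : SF₁ n} (xs : List A) → (∀ {x} → x ∈ˡ xs → f x ≼ g) → ∑ f xs ≼ g
∑-least []       p = 𝟘-≼ _
∑-least (x ∷ xs) p = +-≼ (p (here refl)) (∑-least xs (p ∘ there))

⟦∑⟧⁺ : (f : A → SF₁ n) {x : A} {xs : List A} → x ∈ˡ xs → ∀ {w} → w ∈ ⟦ f x ⟧ → w ∈ ⟦ ∑ f xs ⟧
⟦∑⟧⁺ f (here refl) w∈ = inj₁ w∈
⟦∑⟧⁺ f (there x∈)  w∈ = inj₂ (⟦∑⟧⁺ f x∈ w∈)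

⟦∑⟧⁻ : (f : A → SF₁ n) (xs : List A) → ∀ {w} → w ∈ ⟦ ∑ f xs ⟧ →
       ∃ λ x → x ∈ˡ xs × w ∈ ⟦ f x ⟧
⟦∑⟧⁻ f (x ∷ xs) (inj₁ w∈) = x , here refl , w∈
⟦∑⟧⁻ f (x ∷ xs) (inj₂ w∈) with y , y∈ , w∈fy ← ⟦∑⟧⁻ f xs w∈ = y , there y∈ , w∈fy

bit : Bool → SF₁ n
bit true  = 𝟙
bit false = 𝟘

bit-∧ : (x y : Bool) → bit {n} x · bit y ≡SF₁ bit (x ∧ y)
bit-∧ true  y = ·-identityˡ _
bit-∧ false y = ·-zeroˡ _

bit-∨ : (x y : Bool) → bit {n} x + bit y ≡SF₁ bit (x ∨ y)
bit-∨ true  true  = +-idem _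
bit-∨ true  false = +-identityʳ _
bit-∨ false y     = +-identityˡ _

-- `𝟙` is the unit and `𝟘` the zero of both products.
bit-⊗ : (x : Bool) (e : SF₁ n) → bit x ⊗ e ≡SF₁ bit x · e
bit-⊗ true  e = ≡-trans (⊗-comm _ _) (≡-trans (⊗-identityʳ e) (≡-sym (·-identityˡ e)))
bit-⊗ false e = ≡-trans (⊗-zeroˡ e) (≡-sym (·-zeroˡ e))

∑-bit : (p : A → Bool) (xs : List A) → ∑ (bit {n} ∘ p) xs ≡SF₁ bit (any p xs)
∑-bit p []       = ≡-refl
∑-bit p (x ∷ xs) = ≡-trans (+-congˡ (∑-bit p xs)) (bit-∨ (p x) (any p xs))

∑-if : (f : A → SF₁ n) (b : Bool) (xs : List A) → ∑ f (if b then xs else []) ≡SF₁ bit b · ∑ f xs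
∑-if f true  xs = ≡-sym (·-identityˡ _)
∑-if f false xs = ≡-sym (·-zeroˡ _)

*-bit : (b : Bool) → (e : SF₁ n) → (bit b + e) * ≡SF₁ e *
*-bit true  e = ≡-trans (*-cong (+-comm 𝟙 e)) (*-loop e)
*-bit false e = *-cong (+-identityˡ e)

-- Gaussian elimination.  The predicate P, which need not be decidable, cuts out a set of
-- indices closed under the nonzero coefficients; the constants have to agree only there.
guarded-unique :
  {X : Set} (P : X → Set) (xs : List X) (c d y z : X → SF₁ n) (M : X → X → SF₁ n) →
  (∀ i j → H (M i j) ≡SF₁ 𝟘) →
  (∀ i j → M i j ≡SF₁ 𝟘 ⊎ (P i → P j)) →
  (∀ i → P i → c i ≡SF₁ d i) →
  (∀ i → y i ≡SF₁ c i + ∑ (λ j → M i j · y j) xs) →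
  (∀ i → z i ≡SF₁ d i + ∑ (λ j → M i j · z j) xs) →
  ∀ i → P i → y i ≡SF₁ z i
guarded-unique P [] c d y z M guarded closed c≡d y-eq z-eq i Pi = begin
  y i     ≈⟨ y-eq i ⟩
  c i + 𝟘 ≈⟨ +-congʳ (c≡d i Pi) ⟩
  d i + 𝟘 ≈⟨ z-eq i ⟨
  z i     ∎
guarded-unique {n} {X} P (k ∷ xs) c d y z M guarded closed c≡d y-eq z-eq =
  -- The equation of `k` is solved for its own unknown and substituted into all others. The list
  -- holds only the unknowns left on the right-hand sides, while the equations are kept for every
  -- index; so the recursive call also covers `k`, without back substitution.
  guarded-unique P xs (reduce c) (reduce d) y z (λ i j → M i j + K i · M k j)
    guarded′ closed′ constants (eliminate c y y-eq) (eliminate d z z-eq)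
  where
  K : X → SF₁ n
  K i = M i k · (M k k) *

  reduce : (X → SF₁ n) → (X → SF₁ n)
  reduce c i = c i + K i · c k

  K-zero : ∀ i → M i k ≡SF₁ 𝟘 → ∀ e → K i · e ≡SF₁ 𝟘
  K-zero i p e = ≡-trans (·-congʳ (≡-trans (·-congʳ p) (·-zeroˡ _))) (·-zeroˡ _)

  guarded′ : ∀ i j → H (M i j + K i · M k j) ≡SF₁ 𝟘
  guarded′ i j = begin
    H (M i j + K i · M k j)       ≈⟨ H-+ _ _ ⟩
    H (M i j) + H (K i · M k j)   ≈⟨ +-cong (guarded i j) (H-· _ _) ⟩
    𝟘 + H (K i) · H (M k j)       ≈⟨ +-congˡ (·-congˡ (guarded k j)) ⟩
    𝟘 + H (K i) · 𝟘               ≈⟨ +-congˡ (·-zeroʳ _) ⟩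
    𝟘 + 𝟘                         ≈⟨ +-idem 𝟘 ⟩
    𝟘                             ∎

  -- The new coefficient adds the detour through `k`. Either both legs of the detour preserve `P`,
  -- and the implications compose, or one leg is zero and the detour vanishes.
  closed′ : ∀ i j → M i j + K i · M k j ≡SF₁ 𝟘 ⊎ (P i → P j)
  closed′ i j with closed i j
  ... | inj₂ q = inj₂ q
  ... | inj₁ p with closed i k | closed k j
  ...   | inj₂ q | inj₂ r = inj₂ (r ∘ q)
  ...   | inj₁ q | _      = inj₁ (≡-trans (+-cong p (K-zero i q _)) (+-idem 𝟘))
  ...   | inj₂ _ | inj₁ r = inj₁ (≡-trans (+-cong p (≡-trans (·-congˡ r) (·-zeroʳ _))) (+-idem 𝟘))

  -- The constants at `k` have to agree only if `P k` holds. When this does not follow from `P i`,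
  -- the coefficient towards `k` is zero and both added terms disappear.
  constants : ∀ i → P i → reduce c i ≡SF₁ reduce d i
  constants i Pi with closed i k
  ... | inj₁ p = +-cong (c≡d i Pi) (≡-trans (K-zero i p _) (≡-sym (K-zero i p _)))
  ... | inj₂ q = +-cong (c≡d i Pi) (·-congˡ (c≡d k (q Pi)))

  eliminate : ∀ c y → (∀ i → y i ≡SF₁ c i + ∑ (λ j → M i j · y j) (k ∷ xs)) →
              ∀ i → y i ≡SF₁ reduce c i + ∑ (λ j → (M i j + K i · M k j) · y j) xs
  eliminate c y eq i = begin
    y i
      ≈⟨ eq i ⟩
    c i + (M i k · y k + S i)
      ≈⟨ +-congˡ (+-congʳ (·-congˡ pivot)) ⟨
    c i + (M i k · ((M k k) * · (c k + S k)) + S i)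
      ≈⟨ +-congˡ (+-congʳ (≡-trans (·-assoc _ _ _) (·-distribˡ _ _ _))) ⟩
    c i + ((K i · c k + K i · S k) + S i)
      ≈⟨ +-congˡ (≡-trans (≡-sym (+-assoc _ _ _)) (+-congˡ (+-comm _ _))) ⟩
    c i + (K i · c k + (S i + K i · S k))
      ≈⟨ +-assoc _ _ _ ⟩
    (c i + K i · c k) + (S i + K i · S k)
      ≈⟨ +-congˡ combine ⟨
    reduce c i + ∑ (λ j → (M i j + K i · M k j) · y j) xs ∎
    where
    S : X → SF₁ n
    S i = ∑ (λ j → M i j · y j) xs

    -- The equation of `k` is read as a fixpoint equation in the single unknown `y k`, with all
    -- other terms as its constant part.
    pivot : (M k k) * · (c k + S k) ≡SF₁ y k
    pivot = unique-fixpoint (guarded k k) (begin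
      (c k + S k) + M k k · y k ≈⟨ +-assoc _ _ _ ⟨
      c k + (S k + M k k · y k) ≈⟨ +-congˡ (+-comm _ _) ⟩
      c k + (M k k · y k + S k) ≈⟨ eq k ⟨
      y k                       ∎)

    combine : ∑ (λ j → (M i j + K i · M k j) · y j) xs ≡SF₁ S i + K i · S k
    combine = begin
      ∑ (λ j → (M i j + K i · M k j) · y j) xs
        ≈⟨ ∑-cong (λ j → ≡-trans (·-distribʳ _ _ _) (+-congˡ (≡-sym (·-assoc _ _ _)))) xs ⟩
      ∑ (λ j → M i j · y j + K i · (M k j · y j)) xs
        ≈⟨ ∑-+ _ _ xs ⟩
      S i + ∑ (λ j → K i · (M k j · y j)) xs
        ≈⟨ +-congˡ (∑-distribˡ _ xs _) ⟨
      S i + K i · S k ∎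

-- Automata

record Finite (X : Set) : Set where
  field
    elements : List X
    complete : ∀ x → x ∈ˡ elements
    _≟_      : DecidableEquality X

⊤-finite : Finite ⊤
⊤-finite = record { elements = tt ∷ [] ; complete = λ _ → here refl ; _≟_ = Unit._≟_ }

⊎-finite : Finite X → Finite Y → Finite (X ⊎ Y)
⊎-finite F G = record
  { elements = map inj₁ F.elements ++ map inj₂ G.elements
  ; complete = [ (λ x → ∈-++⁺ˡ (∈-map⁺ inj₁ (F.complete x)))
               , (λ y → ∈-++⁺ʳ _ (∈-map⁺ inj₂ (G.complete y))) ]
  ; _≟_      = Sum.≡-dec F._≟_ G._≟_
  }
  where
  module F = Finite F
  module G = Finite G

×-finite : Finite X → Finite Y → Finite (X × Y)
×-finite F G = record
  { elements = cartesianProduct F.elements G.elements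
  ; complete = λ (x , y) → ∈-cartesianProduct⁺ (F.complete x) (G.complete y)
  ; _≟_      = Product.≡-dec F._≟_ G._≟_
  }
  where
  module F = Finite F
  module G = Finite G

step : (X → SF₁ n) → SL n × X → SF₁ n
step y t = ⌜ proj₁ t ⌝ · y (proj₂ t)

-- A nondeterministic automaton, each state of which is labelled by an expression in such
-- a way that the labels solve the linear system given by the transitions.
record Automaton (n : ℕ) : Set₁ where
  field
    State  : Set
    finite : Finite State
    final  : State → Bool
    next   : State → List (SL n × State)
    label  : State → SF₁ n
    solved : ∀ x → label x ≡SF₁ bit (final x) + ∑ (step label) (next x)

open Automaton

∑-relabel : (y : Y → SF₁ n) (h : X → Y) (ts : List (SL n × X)) →
            ∑ (step y) (map (map₂ h) ts) ≡SF₁ ∑ (step (y ∘ h)) ts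
∑-relabel y h = ∑-map (step y) (map₂ h)

-- New states may move to new and old ones, whereas old states keep their transitions inside `N`.
-- Hence the old equations survive and only those of the new states have to be supplied.
extend : (N : Automaton n) → Finite X → (final′ : X → Bool)
         (next′ : X → List (SL n × (X ⊎ State N))) (label′ : X → SF₁ n) →
         (∀ x → label′ x ≡SF₁ bit (final′ x) + ∑ (step [ label′ , label N ]) (next′ x)) →
         Automaton n
extend N F final′ next′ label′ solved′ = record
  { State  = _
  ; finite = ⊎-finite F (finite N)
  ; final  = [ final′ , final N ]
  ; next   = [ next′ , map (map₂ inj₂) ∘ next N ]
  ; label  = [ label′ , label N ]
  ; solved = λ
    { (inj₁ x) → solved′ x
    ; (inj₂ y) → ≡-trans (solved N y) (+-congˡ (≡-sym (∑-relabel [ label′ , label N ] inj₂ (next N y))))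
    }
  }

union : Automaton n → Automaton n → Automaton n
union M N = extend N (finite M) (final M) (map (map₂ inj₁) ∘ next M) (label M)
  (λ x → ≡-trans (solved M x) (+-congˡ (≡-sym (∑-relabel [ label M , label N ] inj₁ (next M x)))))

-- Recognition is provable rather than semantic: the expression is linked to the label of a state by
-- the axioms.
Recognised : SF₁ n → Set₁
Recognised {n} e = Σ[ M ∈ Automaton n ] ∃ λ x → label M x ≡SF₁ e

recognised-resp : e ≡SF₁ f → Recognised e → Recognised f
recognised-resp p (M , x , q) = M , x , ≡-trans q p

-- The fresh state is an initial state that no transition enters, so a single unfolding of `e` over
-- the labels of `N` suffices.
adjoin : (N : Automaton n) (b : Bool) (ts : List (SL n × State N)) (e : SF₁ n) →
         e ≡SF₁ bit b + ∑ (step (label N)) ts → Recognised e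
adjoin N b ts e p = M , inj₁ tt , ≡-refl
  where
  M = extend N ⊤-finite (λ _ → b) (λ _ → map (map₂ inj₂) ts) (λ _ → e)
    (λ _ → ≡-trans p (+-congˡ (≡-sym (∑-relabel [ (λ _ → e) , label N ] inj₂ ts))))

-- Closure of the recognised expressions under the operations

constant : Bool → Automaton n
constant b = record
  { State  = ⊤
  ; finite = ⊤-finite
  ; final  = λ _ → b
  ; next   = λ _ → []
  ; label  = λ _ → bit b
  ; solved = λ _ → ≡-sym (+-identityʳ _)
  }

recognised-bit : ∀ b → Recognised {n} (bit b)
recognised-bit b = constant b , tt , ≡-refl

recognised-letter : ∀ a → Recognised {n} (letter a)
recognised-letter a = adjoin (constant true) false ((letter a , tt) ∷ []) (letter a)
  (≡-sym (≡-trans (+-identityˡ _) (≡-trans (+-identityʳ _) (·-identityʳ _))))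

recognised-+ : Recognised e → Recognised f → Recognised (e + f)
recognised-+ {e = e} {f} (M , x , p) (N , y , q) =
  adjoin U (final M x ∨ final N y) (next U (inj₁ x) ++ next U (inj₂ y)) (e + f) (begin
    e + f
      ≈⟨ +-cong p q ⟨
    label M x + label N y
      ≈⟨ +-cong (solved U (inj₁ x)) (solved U (inj₂ y)) ⟩
    (bit (final M x) + _) + (bit (final N y) + _)
      ≈⟨ +-interchange _ _ _ _ ⟩
    (bit (final M x) + bit (final N y)) + (_ + _)
      ≈⟨ +-cong (bit-∨ (final M x) (final N y)) (≡-sym (∑-++ (step (label U)) (next U (inj₁ x)) _)) ⟩
    bit (final M x ∨ final N y) + ∑ (step (label U)) (next U (inj₁ x) ++ next U (inj₂ y)) ∎)
  where
  U = union M N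

∑-step-· : (y : X → SF₁ n) (ts : List (SL n × X)) (e : SF₁ n) →
           ∑ (step y) ts · e ≡SF₁ ∑ (step (λ x → y x · e)) ts
∑-step-· y ts e = ≡-trans (∑-distribʳ (step y) ts e) (∑-cong (λ _ → ≡-sym (·-assoc _ _ _)) ts)

-- `f` is unfolded only behind the constant part of `e`. Behind `d` it stays whole, to be absorbed
-- into the labels of the successor states.
·-solved : ∀ a b {d g : SF₁ n} → e ≡SF₁ bit a + d → f ≡SF₁ bit b + g →
           e · f ≡SF₁ bit (a ∧ b) + (d · f + bit a · g)
·-solved {e = e} {f} a b {d} {g} p q = begin
  e · f
    ≈⟨ ·-congʳ p ⟩
  (bit a + d) · f
    ≈⟨ ·-distribʳ _ _ _ ⟩
  bit a · f + d · f
    ≈⟨ +-congʳ (≡-trans (·-congˡ q) (·-distribˡ _ _ _)) ⟩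
  (bit a · bit b + bit a · g) + d · f
    ≈⟨ +-assoc _ _ _ ⟨
  bit a · bit b + (bit a · g + d · f)
    ≈⟨ +-cong (bit-∧ a b) (+-comm _ _) ⟩
  bit (a ∧ b) + (d · f + bit a · g) ∎

-- The states of `M` are relabelled by appending `f`, and those that are final also receive the
-- first transitions of `y`, through which a run passes into `N`.
recognised-· : Recognised e → Recognised f → Recognised (e · f)
recognised-· {f = f} (M , x , p) (N , y , q) =
  extend N (finite M) (λ x → final M x ∧ final N y) next′ label′ solved′ , inj₁ x , ·-congʳ p
  where
  label′ = λ x → label M x · f
  ℓ      = [ label′ , label N ]
  next′  = λ x → map (map₂ inj₁) (next M x) ++
                 (if final M x then map (map₂ inj₂) (next N y) else [])

  solved′ : ∀ x → _
  solved′ x = begin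
    label M x · f
      ≈⟨ ·-solved (final M x) (final N y) (solved M x) (≡-trans (≡-sym q) (solved N y)) ⟩
    bit (final M x ∧ final N y) +
      (∑ (step (label M)) (next M x) · f + bit (final M x) · ∑ (step (label N)) (next N y))
      ≈⟨ +-congˡ (+-cong
           (≡-trans (∑-step-· (label M) (next M x) f) (≡-sym (∑-relabel ℓ inj₁ (next M x))))
           (≡-sym (≡-trans (∑-if (step ℓ) (final M x) _)
             (·-congˡ (∑-relabel ℓ inj₂ (next N y)))))) ⟩
    bit (final M x ∧ final N y) +
      (∑ (step ℓ) (map (map₂ inj₁) (next M x)) +
       ∑ (step ℓ) (if final M x then map (map₂ inj₂) (next N y) else []))
      ≈⟨ +-congˡ (∑-++ (step ℓ) (map (map₂ inj₁) (next M x)) _) ⟨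
    bit (final M x ∧ final N y) + ∑ (step ℓ) (next′ x) ∎

-- In `N` the labels of `M` are followed by `e *`, and final states may start again with the
-- transitions of `x`. Since `e *` itself need not be such a label, an initial state is adjoined.
recognised-* : Recognised e → Recognised (e *)
recognised-* {n} {e} (M , x , p) = adjoin N true (next M x) (e *) unfold
  where
  label′ = λ y → label M y · e *

  -- e and its part without the empty word have the same star.
  unfold : e * ≡SF₁ 𝟙 + ∑ (step label′) (next M x)
  unfold = begin
    e *
      ≈⟨ e*≡d* ⟩
    d *
      ≈⟨ *-unfoldˡ d ⟩
    𝟙 + d · d *
      ≈⟨ +-congˡ (≡-trans (·-congˡ (≡-sym e*≡d*)) (∑-step-· (label M) (next M x) (e *))) ⟩
    𝟙 + ∑ (step label′) (next M x) ∎
    where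
    d = ∑ (step (label M)) (next M x)

    e*≡d* : e * ≡SF₁ d *
    e*≡d* = ≡-trans (*-cong (≡-trans (≡-sym p) (solved M x))) (*-bit (final M x) d)

  next′ = λ y → next M y ++ (if final M y then next M x else [])

  N : Automaton n
  N = record
    { State  = State M
    ; finite = finite M
    -- The factor `true` is the constant part of `e *`, in the form that `·-solved` produces.
    ; final  = λ y → final M y ∧ true
    ; next   = next′
    ; label  = label′
    ; solved = λ y → begin
        label M y · e *
          ≈⟨ ·-solved (final M y) true (solved M y) unfold ⟩
        bit (final M y ∧ true) +
          (∑ (step (label M)) (next M y) · e * + bit (final M y) · ∑ (step label′) (next M x))
          ≈⟨ +-congˡ (+-cong (∑-step-· (label M) (next M y) (e *))
                             (≡-sym (∑-if (step label′) (final M y) (next M x)))) ⟩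
        bit (final M y ∧ true) +
          (∑ (step label′) (next M y) + ∑ (step label′) (if final M y then next M x else []))
          ≈⟨ +-congˡ (∑-++ (step label′) (next M y) _) ⟨
        bit (final M y ∧ true) + ∑ (step label′) (next′ y) ∎
    }

⊗-solved : ∀ a b {d g : SF₁ n} → e ≡SF₁ bit a + d → f ≡SF₁ bit b + g →
           e ⊗ f ≡SF₁ bit (a ∧ b) + (d ⊗ g + (bit a · g + bit b · d))
⊗-solved {e = e} {f} a b {d} {g} p q = begin
  e ⊗ f
    ≈⟨ ⊗-cong p q ⟩
  (bit a + d) ⊗ (bit b + g)
    ≈⟨ ⊗-distribʳ _ _ _ ⟩
  bit a ⊗ (bit b + g) + d ⊗ (bit b + g)
    ≈⟨ +-cong (≡-trans (bit-⊗ a _) (·-distribˡ _ _ _)) (⊗-distribˡ _ _ _) ⟩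
  (bit a · bit b + bit a · g) + (d ⊗ bit b + d ⊗ g)
    ≈⟨ +-cong (+-congʳ (bit-∧ a b)) (≡-trans (+-congʳ (≡-trans (⊗-comm _ _) (bit-⊗ b d))) (+-comm _ _)) ⟩
  (bit (a ∧ b) + bit a · g) + (d ⊗ g + bit b · d)
    ≈⟨ ≡-trans (≡-sym (+-assoc _ _ _)) (+-congˡ (+-assoc _ _ _)) ⟩
  bit (a ∧ b) + ((bit a · g + d ⊗ g) + bit b · d)
    ≈⟨ +-congˡ (≡-trans (+-congʳ (+-comm _ _)) (≡-sym (+-assoc _ _ _))) ⟩
  bit (a ∧ b) + (d ⊗ g + (bit a · g + bit b · d)) ∎

-- Pairs of states run synchronously. Because a word may outlast its partner, the states of both
-- automata are kept as well: when one side is final, the other may continue alone.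
recognised-⊗ : Recognised e → Recognised f → Recognised (e ⊗ f)
recognised-⊗ {n} (M , x , p) (N , y , q) =
  extend U (×-finite (finite M) (finite N)) (λ (x , y) → final M x ∧ final N y) next′ label′ solved′ ,
  inj₁ (x , y) , ⊗-cong p q
  where
  U = union M N
  S = (State M × State N) ⊎ State U

  label′ : State M × State N → SF₁ n
  label′ (x , y) = label M x ⊗ label N y

  sync : SL n × State M → SL n × State N → SL n × S
  sync (α , x) (β , y) = α ⊗ β , inj₁ (x , y)

  left : State M → List (SL n × S)
  left x = map (map₂ (inj₂ ∘ inj₁)) (next M x)

  right : State N → List (SL n × S)
  right y = map (map₂ (inj₂ ∘ inj₂)) (next N y)

  next′ : State M × State N → List (SL n × S)
  next′ (x , y) = cartesianProductWith sync (next M x) (next N y) ++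
    ((if final M x then right y else []) ++ (if final N y then left x else []))

  ℓ = [ label′ , label U ]

  solved′ : ∀ z → label′ z ≡SF₁ _ + ∑ (step ℓ) (next′ z)
  solved′ (x , y) = begin
    label M x ⊗ label N y
      ≈⟨ ⊗-solved (final M x) (final N y) (solved M x) (solved N y) ⟩
    bit (final M x ∧ final N y) +
      (∑ (step (label M)) (next M x) ⊗ ∑ (step (label N)) (next N y) +
       (bit (final M x) · ∑ (step (label N)) (next N y) + bit (final N y) · ∑ (step (label M)) (next M x)))
      ≈⟨ +-congˡ (+-cong
           (∑-⊗ (step (label M)) (step (label N)) (step ℓ) sync (λ _ _ → ⊗-sync _ _ _ _) (next M x) (next N y))
           (≡-sym (≡-trans (∑-++ (step ℓ) (if final M x then right y else []) _) (+-cong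
             (≡-trans (∑-if (step ℓ) (final M x) (right y)) (·-congˡ (∑-relabel ℓ (inj₂ ∘ inj₂) (next N y))))
             (≡-trans (∑-if (step ℓ) (final N y) (left x)) (·-congˡ (∑-relabel ℓ (inj₂ ∘ inj₁) (next M x)))))))) ⟩
    bit (final M x ∧ final N y) +
      (∑ (step ℓ) (cartesianProductWith sync (next M x) (next N y)) +
       ∑ (step ℓ) ((if final M x then right y else []) ++ (if final N y then left x else [])))
      ≈⟨ +-congˡ (∑-++ (step ℓ) (cartesianProductWith sync (next M x) (next N y)) _) ⟨
    bit (final M x ∧ final N y) + ∑ (step ℓ) (next′ (x , y)) ∎

H-∑-step : (y : X → SF₁ n) (ts : List (SL n × X)) → H (∑ (step y) ts) ≡SF₁ 𝟘
H-∑-step y []       = H-𝟘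
H-∑-step y (t ∷ ts) = begin
  H (step y t + ∑ (step y) ts)                  ≈⟨ H-+ _ _ ⟩
  H (step y t) + H (∑ (step y) ts)              ≈⟨ +-cong (H-· _ _) (H-∑-step y ts) ⟩
  H ⌜ proj₁ t ⌝ · H (y (proj₂ t)) + 𝟘           ≈⟨ +-identityʳ _ ⟩
  H ⌜ proj₁ t ⌝ · H (y (proj₂ t))               ≈⟨ ·-congʳ (H-SL (proj₁ t)) ⟩
  𝟘 · H (y (proj₂ t))                           ≈⟨ ·-zeroˡ _ ⟩
  𝟘                                             ∎

H-bit : ∀ b → H (bit {n} b) ≡SF₁ bit b
H-bit true  = H-𝟙
H-bit false = H-𝟘

-- `H` annihilates every transition term, since each begins with a semilattice term; only the
-- constant part remains.
recognised-H : Recognised e → Recognised (H e)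
recognised-H {e = e} (M , x , p) = recognised-resp (≡-sym eq) (recognised-bit (final M x))
  where
  eq : H e ≡SF₁ bit (final M x)
  eq = begin
    H e
      ≈⟨ H-cong (≡-trans (≡-sym p) (solved M x)) ⟩
    H (bit (final M x) + ∑ (step (label M)) (next M x))
      ≈⟨ H-+ _ _ ⟩
    H (bit (final M x)) + H (∑ (step (label M)) (next M x))
      ≈⟨ +-cong (H-bit (final M x)) (H-∑-step (label M) (next M x)) ⟩
    bit (final M x) + 𝟘
      ≈⟨ +-identityʳ _ ⟩
    bit (final M x) ∎

recognised : (e : SF₁ n) → Recognised e
recognised 𝟘          = recognised-bit false
recognised 𝟙          = recognised-bit true
recognised (letter a) = recognised-letter a
recognised (e + f)    = recognised-+ (recognised e) (recognised f)
recognised (e · f)    = recognised-· (recognised e) (recognised f)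
recognised (e ⊗ f)    = recognised-⊗ (recognised e) (recognised f)
recognised (e *)      = recognised-* (recognised e)
recognised (H e)      = recognised-H (recognised e)

-- Determinisation and completeness

-- Associativity and commutativity bring the new letter next to its occurrence in `α`, where
-- idempotence removes it.
absorb-letter : (α : SL n) {a : Fin n} → a ∈ˢ value ⟦ α ⟧SL → ⌜ α ⌝ ⊗ letter a ≡SF₁ ⌜ α ⌝
absorb-letter (letter b) a∈ with refl ← x∈⁅y⁆⇒x≡y b a∈ = ⊗-idem-SL (letter b)
absorb-letter (α ⊗ β) a∈ with x∈p∪q⁻ (value ⟦ α ⟧SL) (value ⟦ β ⟧SL) a∈
... | inj₂ a∈β = ≡-trans (≡-sym (⊗-assoc _ _ _)) (⊗-cong ≡-refl (absorb-letter β a∈β))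
... | inj₁ a∈α = begin
  (⌜ α ⌝ ⊗ ⌜ β ⌝) ⊗ letter _ ≈⟨ ⊗-cong (⊗-comm _ _) ≡-refl ⟩
  (⌜ β ⌝ ⊗ ⌜ α ⌝) ⊗ letter _ ≈⟨ ⊗-assoc _ _ _ ⟨
  ⌜ β ⌝ ⊗ (⌜ α ⌝ ⊗ letter _) ≈⟨ ⊗-cong ≡-refl (absorb-letter α a∈α) ⟩
  ⌜ β ⌝ ⊗ ⌜ α ⌝              ≈⟨ ⊗-comm _ _ ⟩
  ⌜ α ⌝ ⊗ ⌜ β ⌝              ∎

absorb : (α β : SL n) → value ⟦ β ⟧SL ⊆ˢ value ⟦ α ⟧SL → ⌜ α ⌝ ⊗ ⌜ β ⌝ ≡SF₁ ⌜ α ⌝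
absorb α (letter b) β⊆α = absorb-letter α (β⊆α (x∈⁅x⁆ b))
absorb α (β ⊗ γ)    β⊆α = begin
  ⌜ α ⌝ ⊗ (⌜ β ⌝ ⊗ ⌜ γ ⌝) ≈⟨ ⊗-assoc _ _ _ ⟩
  (⌜ α ⌝ ⊗ ⌜ β ⌝) ⊗ ⌜ γ ⌝ ≈⟨ ⊗-cong (absorb α β (β⊆α ∘ x∈p∪q⁺ ∘ inj₁)) ≡-refl ⟩
  ⌜ α ⌝ ⊗ ⌜ γ ⌝           ≈⟨ absorb α γ (β⊆α ∘ x∈p∪q⁺ ∘ inj₂) ⟩
  ⌜ α ⌝                   ∎

-- Each of the two terms absorbs the letters of the other, so both equal their product.
SL-complete : (α β : SL n) → value ⟦ α ⟧SL ≡ value ⟦ β ⟧SL → ⌜ α ⌝ ≡SF₁ ⌜ β ⌝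
SL-complete α β eq = begin
  ⌜ α ⌝         ≈⟨ absorb α β (⊆-reflexive (sym eq)) ⟨
  ⌜ α ⌝ ⊗ ⌜ β ⌝ ≈⟨ ⊗-comm _ _ ⟩
  ⌜ β ⌝ ⊗ ⌜ α ⌝ ≈⟨ absorb β α (⊆-reflexive eq) ⟩
  ⌜ β ⌝         ∎

sublists : List X → List (List X)
sublists []       = [] ∷ []
sublists (x ∷ xs) = map (x ∷_) (sublists xs) ++ sublists xs

-- Every value of the transition function `δ` below is such a filter, so the sublists of the list of
-- states contain all of its values.
filter-∈-sublists : {P : X → Set} (P? : Decidable P) (xs : List X) → filter P? xs ∈ˡ sublists xs
filter-∈-sublists P? []       = here refl
filter-∈-sublists P? (x ∷ xs) with P? x
... | yes _ = ∈-++⁺ˡ (∈-map⁺ (x ∷_) (filter-∈-sublists P? xs))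
... | no  _ = ∈-++⁺ʳ _ (filter-∈-sublists P? xs)

[]∈⟦bit⟧⁻ : ∀ b → [] ∈ ⟦ bit {n} b ⟧ → b ≡ true
[]∈⟦bit⟧⁻ true _ = refl

∷∉⟦bit⟧ : ∀ b {x w} → ¬ (x ∷ w) ∈ ⟦ bit {n} b ⟧
∷∉⟦bit⟧ true  ()
∷∉⟦bit⟧ false ()

-- The subset construction; a set of states is represented by a list, and δ always returns
-- a sublist of the list of all states.
module Subsets {n : ℕ} (M : Automaton n) where

  module F = Finite (finite M)
  open DecMembership F._≟_ using (_∈?_)

  -- These are terms, and several of them may denote the same subset. As `δ` depends only on the
  -- subset, such terms lead to the same set of states.
  letters : List (SL n)
  letters = map proj₁ (concatMap (next M) F.elements)

  sumLabel : List (State M) → SF₁ n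
  sumLabel = ∑ (label M)

  transitions : List (State M) → List (SL n × State M)
  transitions = concatMap (next M)

  _≟ˢ_ : DecidableEquality (Subset n)
  _≟ˢ_ = Vec.≡-dec Bool._≟_

  reads? : (p : Subset n) → Decidable (λ (t : SL n × State M) → value ⟦ proj₁ t ⟧SL ≡ p)
  reads? p t = value ⟦ proj₁ t ⟧SL ≟ˢ p

  δ : Subset n → List (State M) → List (State M)
  δ p S = filter (_∈? map proj₂ (filter (reads? p) (transitions S))) F.elements

  ∈-δ⁺ : ∀ {α x S} → (α , x) ∈ˡ transitions S → x ∈ˡ δ (value ⟦ α ⟧SL) S
  ∈-δ⁺ t∈ = ∈-filter⁺ (_∈? _) (F.complete _) (∈-map⁺ proj₂ (∈-filter⁺ (reads? _) t∈ refl))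

  ∈-δ⁻ : ∀ {p x} S → x ∈ˡ δ p S → ∃ λ α → (α , x) ∈ˡ transitions S × value ⟦ α ⟧SL ≡ p
  ∈-δ⁻ {p} S x∈ with ∈-map⁻ proj₂ (proj₂ (∈-filter⁻ (_∈? _) {xs = F.elements} x∈))
  ... | (α , x) , t∈ , refl with t∈S , eq ← ∈-filter⁻ (reads? p) {xs = transitions S} t∈ = α , t∈S , eq

  ∈-letters : ∀ {t} S → t ∈ˡ transitions S → proj₁ t ∈ˡ letters
  ∈-letters S t∈ with Any.satisfied (∈-concatMap⁻ (next M) {xs = S} t∈)
  ... | x , t∈x = ∈-map⁺ proj₁ (∈-concatMap⁺ (next M) (lose (F.complete x) t∈x))

  ∑-transitions : ∀ S → sumLabel S ≡SF₁ bit (any (final M) S) + ∑ (step (label M)) (transitions S)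
  ∑-transitions S = ≡-trans (sum S) (+-congʳ (∑-bit (final M) S))
    where
    sum : ∀ S → sumLabel S ≡SF₁ ∑ (bit ∘ final M) S + ∑ (step (label M)) (transitions S)
    sum []      = ≡-sym (+-idem 𝟘)
    sum (x ∷ S) = begin
      label M x + sumLabel S
        ≈⟨ +-cong (solved M x) (sum S) ⟩
      (bit (final M x) + ∑ (step (label M)) (next M x)) + (_ + ∑ (step (label M)) (transitions S))
        ≈⟨ +-interchange _ _ _ _ ⟩
      (bit (final M x) + _) + (∑ (step (label M)) (next M x) + ∑ (step (label M)) (transitions S))
        ≈⟨ +-congˡ (∑-++ (step (label M)) (next M x) _) ⟨
      (bit (final M x) + _) + ∑ (step (label M)) (transitions (x ∷ S)) ∎

  move : (S : List (State M)) → SL n → SF₁ n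
  move S α = ⌜ α ⌝ · sumLabel (δ (value ⟦ α ⟧SL) S)

  -- A transition of `S` lies below the move along its own term. Conversely, a state reached by the
  -- move along `α` is the target of a transition whose term `β` denotes the same subset, and
  -- `SL-complete` exchanges `α` for `β`.
  deterministic : ∀ S → sumLabel S ≡SF₁ bit (any (final M) S) + ∑ (move S) letters
  deterministic S = ≡-trans (∑-transitions S) (+-congˡ (≼-antisym
    (∑-least (transitions S) λ {(α , x)} t∈ → ≼-trans
      (·-monoʳ-≼ (∑-upper (label M) (∈-δ⁺ {S = S} t∈)))
      (∑-upper (move S) (∈-letters S t∈)))
    (∑-least letters λ {α} _ → ≼-trans
      (≼-reflexive (∑-distribˡ (label M) (δ (value ⟦ α ⟧SL) S) ⌜ α ⌝))
      (∑-least (δ (value ⟦ α ⟧SL) S) λ {x} x∈ → let β , t∈ , eq = ∈-δ⁻ S x∈ in ≼-trans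
        (≼-reflexive (·-congʳ (SL-complete α β (sym eq))))
        (∑-upper (step (label M)) t∈)))))

  -- This and the next three facts read the language off the provable equation `deterministic` by
  -- means of soundness.
  []∈⁻ : ∀ S → [] ∈ ⟦ sumLabel S ⟧ → any (final M) S ≡ true
  []∈⁻ S ε∈ with proj₁ (sound (deterministic S)) ε∈
  ... | inj₁ ε∈bit = []∈⟦bit⟧⁻ (any (final M) S) ε∈bit
  ... | inj₂ ε∈∑ with ⟦∑⟧⁻ (move S) letters ε∈∑
  ...   | α , _ , [] , _ , ε∈α , _ with () ← proj₁ ⟦⌜ α ⌝⟧ ε∈α

  []∈⁺ : ∀ S → any (final M) S ≡ true → [] ∈ ⟦ sumLabel S ⟧
  []∈⁺ S eq = proj₂ (sound (deterministic S)) (inj₁ (subst (λ b → [] ∈ ⟦ bit b ⟧) (sym eq) refl))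

  ∷∈⁺ : ∀ {α w} S → α ∈ˡ letters →
         w ∈ ⟦ sumLabel (δ (value ⟦ α ⟧SL) S) ⟧ → (⟦ α ⟧SL ∷ w) ∈ ⟦ sumLabel S ⟧
  ∷∈⁺ {α} S α∈ w∈ = proj₂ (sound (deterministic S))
    (inj₂ (⟦∑⟧⁺ (move S) α∈ (_ , _ , proj₂ ⟦⌜ α ⌝⟧ refl , w∈ , refl)))

  ∷∈⁻ : ∀ {x w} S → (x ∷ w) ∈ ⟦ sumLabel S ⟧ → w ∈ ⟦ sumLabel (δ (value x) S) ⟧
  ∷∈⁻ S xw∈ with proj₁ (sound (deterministic S)) xw∈
  ... | inj₁ xw∈bit = contradiction xw∈bit (∷∉⟦bit⟧ (any (final M) S))
  ... | inj₂ xw∈∑ with ⟦∑⟧⁻ (move S) letters xw∈∑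
  ...   | α , _ , _ , _ , u∈α , w∈ , eq with proj₁ ⟦⌜ α ⌝⟧ u∈α | eq
  ...     | refl | refl = w∈

  -- The linear system indexed by pairs of sets of states

  Pair : Set
  Pair = List (State M) × List (State M)

  Equivalent : Pair → Set
  Equivalent (S , T) = ⟦ sumLabel S ⟧ ≐ ⟦ sumLabel T ⟧

  δ₂ : SL n → Pair → Pair
  δ₂ α (S , T) = δ (value ⟦ α ⟧SL) S , δ (value ⟦ α ⟧SL) T

  _≟ᴾ_ : DecidableEquality Pair
  _≟ᴾ_ = Product.≡-dec (List.≡-dec F._≟_) (List.≡-dec F._≟_)

  pairs : List Pair
  pairs = cartesianProduct (sublists F.elements) (sublists F.elements)

  coefficient : Pair → Pair → SL n → SF₁ n
  coefficient i j α with δ₂ α i ≟ᴾ j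
  ... | yes _ = ⌜ α ⌝
  ... | no  _ = 𝟘

  matrix : Pair → Pair → SF₁ n
  matrix i j = ∑ (coefficient i j) letters

  coefficient-δ₂ : ∀ α i → coefficient i (δ₂ α i) α ≡ ⌜ α ⌝
  coefficient-δ₂ α i with δ₂ α i ≟ᴾ δ₂ α i
  ... | yes _ = refl
  ... | no  q = contradiction refl q

  -- The sum over letters is regrouped by target pair. Each `δ₂ α i` occurs in `pairs`, and a letter
  -- contributes `𝟘` to every other column.
  ∑-matrix : (y : Pair → SF₁ n) (i : Pair) →
             ∑ (λ α → ⌜ α ⌝ · y (δ₂ α i)) letters ≡SF₁ ∑ (λ j → matrix i j · y j) pairs
  ∑-matrix y i = ≼-antisym
    (∑-least letters λ {α} α∈ → ≼-trans
      (·-monoˡ-≼ (subst (_≼ matrix i (δ₂ α i)) (coefficient-δ₂ α i) (∑-upper (coefficient i (δ₂ α i)) α∈)))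
      (∑-upper (λ j → matrix i j · y j)
        (∈-cartesianProduct⁺ (filter-∈-sublists _ F.elements) (filter-∈-sublists _ F.elements))))
    (∑-least pairs λ {j} _ → ≼-trans
      (≼-reflexive (∑-distribʳ (coefficient i j) letters (y j)))
      (∑-least letters (entry j)))
    where
    entry : ∀ j {α} → α ∈ˡ letters → coefficient i j α · y j ≼ ∑ (λ α → ⌜ α ⌝ · y (δ₂ α i)) letters
    entry j {α} α∈ with δ₂ α i ≟ᴾ j
    ... | yes refl = ∑-upper (λ α → ⌜ α ⌝ · y (δ₂ α i)) α∈
    ... | no  _    = ≼-trans (≼-reflexive (·-zeroˡ _)) (𝟘-≼ _)

  matrix-guarded : ∀ i j → H (matrix i j) ≡SF₁ 𝟘
  matrix-guarded i j = go letters
    where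
    H-coefficient : ∀ α → H (coefficient i j α) ≡SF₁ 𝟘
    H-coefficient α with δ₂ α i ≟ᴾ j
    ... | yes _ = H-SL α
    ... | no  _ = H-𝟘

    go : ∀ αs → H (∑ (coefficient i j) αs) ≡SF₁ 𝟘
    go []       = H-𝟘
    go (α ∷ αs) = ≡-trans (H-+ _ _) (≡-trans (+-cong (H-coefficient α) (go αs)) (+-idem 𝟘))

  -- Equal languages have equal derivatives by the letter that `α` denotes.
  δ₂-equivalent : ∀ {α} → α ∈ˡ letters → ∀ i → Equivalent i → Equivalent (δ₂ α i)
  δ₂-equivalent α∈ (S , T) (S⊆T , T⊆S) =
    (λ w∈ → ∷∈⁻ T (S⊆T (∷∈⁺ S α∈ w∈))) , (λ w∈ → ∷∈⁻ S (T⊆S (∷∈⁺ T α∈ w∈)))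

  -- What is decided is whether some letter leads from `i` to `j`, not whether languages agree: if
  -- one does, equivalence is inherited along it, and otherwise all summands are `𝟘`.
  matrix-closed : ∀ i j → matrix i j ≡SF₁ 𝟘 ⊎ (Equivalent i → Equivalent j)
  matrix-closed i j = go letters (λ α∈ → α∈)
    where
    go : ∀ αs → (∀ {α} → α ∈ˡ αs → α ∈ˡ letters) →
         ∑ (coefficient i j) αs ≡SF₁ 𝟘 ⊎ (Equivalent i → Equivalent j)
    go []       αs⊆ = inj₁ ≡-refl
    go (α ∷ αs) αs⊆ with δ₂ α i ≟ᴾ j | go αs (αs⊆ ∘ there)
    ... | yes refl | _      = inj₂ (δ₂-equivalent (αs⊆ (here refl)) i)
    ... | no _     | inj₁ p = inj₁ (≡-trans (+-identityˡ _) p)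
    ... | no _     | inj₂ q = inj₂ q

  equivalent⇒≡SF₁ : ∀ i → Equivalent i → sumLabel (proj₁ i) ≡SF₁ sumLabel (proj₂ i)
  equivalent⇒≡SF₁ = guarded-unique Equivalent pairs
    (bit ∘ any (final M) ∘ proj₁) (bit ∘ any (final M) ∘ proj₂)
    (sumLabel ∘ proj₁) (sumLabel ∘ proj₂) matrix matrix-guarded matrix-closed
    -- Both bits record whether the empty word lies in the language, so they agree when the
    -- languages do.
    (λ (S , T) (S⊆T , T⊆S) → subst (λ b → bit (any (final M) S) ≡SF₁ bit b)
      (Bool.⇔→≡ {z = true} (mk⇔ ([]∈⁻ T ∘ S⊆T ∘ []∈⁺ S) ([]∈⁻ S ∘ T⊆S ∘ []∈⁺ T))) ≡-refl)
    (λ i → ≡-trans (deterministic (proj₁ i)) (+-congˡ (∑-matrix (sumLabel ∘ proj₁) i)))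
    (λ i → ≡-trans (deterministic (proj₂ i)) (+-congˡ (∑-matrix (sumLabel ∘ proj₂) i)))

  labels-complete : ∀ x y → ⟦ label M x ⟧ ≐ ⟦ label M y ⟧ → label M x ≡SF₁ label M y
  labels-complete x y (x⊆y , y⊆x) = begin
    -- Adding `𝟘` turns the label into `sumLabel` of a one-element list.
    label M x     ≈⟨ +-identityʳ _ ⟨
    label M x + 𝟘 ≈⟨ equivalent⇒≡SF₁ (x ∷ [] , y ∷ []) 
                      (∪∅-mono ⟦ label M x ⟧ ⟦ label M y ⟧ x⊆y , ∪∅-mono ⟦ label M y ⟧ ⟦ label M x ⟧ y⊆x) ⟩
    label M y + 𝟘 ≈⟨ +-identityʳ _ ⟩
    label M y     ∎
    where
    ∪∅-mono : (K L : SyncLanguage n) → K ⊆ L → K ∪ ∅ ⊆ L ∪ ∅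
    ∪∅-mono K L K⊆L (inj₁ w∈) = inj₁ (K⊆L w∈)

complete : (e f : SF₁ n) → ⟦ e ⟧ ≐ ⟦ f ⟧ → e ≡SF₁ f
complete e f (e⊆f , f⊆e) with recognised e | recognised f
... | M , x , p | N , y , q = begin
  e         ≈⟨ p ⟨
  -- In the union both expressions are represented by states of one automaton; soundness of `p` and
  -- `q` carries the equality of languages over to the labels.
  label M x ≈⟨ Subsets.labels-complete (union M N) (inj₁ x) (inj₂ y)
                 ( (λ w∈ → proj₂ (sound q) (e⊆f (proj₁ (sound p) w∈)))
                 , (λ w∈ → proj₂ (sound p) (f⊆e (proj₁ (sound q) w∈)))) ⟩
  label N y ≈⟨ q ⟩
  f         ∎

theorem7p7 : (n : ℕ) (e f : SF₁ n) → e ≡SF₁ f ⇔ ⟦ e ⟧ ≐ ⟦ f ⟧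
theorem7p7 n e f = mk⇔ sound (complete e f)
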